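{- Let $t \geq 1$ and $\omega \geq 2$ be integers with $\frac{1}{2}(t+1) \leq \omega \leq t$. Then there exists a graph $G$ of treewidth $t$ and clique number $\omega$ satisfying \[\chi_f(G) \geq t + 1 - \sum_{i = 1}^{t - \omega + 1 } \frac{1}{\omega - i + 1}.\]
   Context: Graphs are finite and simple. The clique number of $G$ is the number of vertices in a largest clique of $G$. A $t$-tree is a graph obtained by starting with a $t$-clique and then iteratively adding vertices $v$ such that, at the time $v$ is added, its neighborhood $N(v)$ induces a $K_t$. A partial $t$-tree is a subgraph of a $t$-tree. The treewidth of $G$ is the minimum $t$ for which $G$ is a partial $t$-tree (this agrees with the usual definition of treewidth). A fractional coloring of $G$ assigns to each vertex $v \in V(G)$ a set $\phi(v) \subseteq \mathbb{R}$ of Lebesgue measure $\mu(\phi(v)) = 1$ so that $\phi(u) \cap \phi(v) = \emptyset$ for each edge $uv \in E(G)$. The fractional chromatic number $\chi_f(G)$ is the infimum of $\mu\left(\bigcup_{v \in V(G)} \phi(v)\right)$ over all fractional colorings $\phi$ of $G$. Equivalently, $\chi_f(G) = \inf_{b \geq 1} \chi_b(G)/b$, where $\chi_b(G)$ is the least $k$ such that one can assign to each vertex a $b$-element subset of $\{1,\dots,k\}$ with adjacent vertices receiving disjoint subsets. -}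

module Defs where

open import Data.Empty using (⊥)
open import Data.Fin using (Fin; zero; suc; _≟_)
open import Data.Fin.Subset using (Subset; _∈_; _∩_; ∣_∣; Empty)
open import Data.Fin.Subset.Properties using (_∈?_)
open import Data.Integer using (+_)
open import Data.Nat using (ℕ; zero; suc; NonZero; _≤_)
open import Data.Product using (_×_; ∃; ∃-syntax)
open import Data.Rational as ℚ using (ℚ; 0ℚ; _/_)
open import Function.Definitions using (Injective)
open import Level using (0ℓ)
open import Relation.Binary.Core using (Rel)
open import Relation.Binary.Definitions using (Decidable; Symmetric; Irreflexive)
open import Relation.Binary.PropositionalEquality using (_≡_; _≢_; refl; ≢-sym)
open import Relation.Nullary using (no; ¬?)

-- Finite simple graphs, with vertex set Fin order.
record Graph : Set₁ where
  field
    order  : ℕ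
    Adj    : Rel (Fin order) 0ℓ
    adj?   : Decidable Adj
    sym    : Symmetric Adj
    irrefl : Irreflexive _≡_ Adj

open Graph using (order; Adj)

IsClique : (G : Graph) → Subset (order G) → Set
IsClique G S = ∀ u v → u ∈ S → v ∈ S → u ≢ v → Adj G u v

IsCliqueNumber : Graph → ℕ → Set
IsCliqueNumber G ω =
    (∃[ S ] IsClique G S × ∣ S ∣ ≡ ω)
  × (∀ S → IsClique G S → ∣ S ∣ ≤ ω)

K : ℕ → Graph
K t = record
  { order  = t
  ; Adj    = _≢_
  ; adj?   = λ u v → ¬? (u ≟ v)
  ; sym    = ≢-sym
  ; irrefl = λ u≡v u≢v → u≢v u≡v
  }

-- G with a new vertex, zero, whose neighbourhood is S; an old vertex v of G
-- becomes suc v.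
addVertex : (G : Graph) → Subset (order G) → Graph
addVertex G S = record
  { order  = suc (order G)
  ; Adj    = adj
  ; adj?   = dec
  ; sym    = λ {u} {v} → symm u v
  ; irrefl = λ {u} {v} → irr u v
  }
  where
  adj : Rel (Fin (suc (order G))) 0ℓ
  adj zero    zero    = ⊥
  adj zero    (suc v) = v ∈ S
  adj (suc u) zero    = u ∈ S
  adj (suc u) (suc v) = Adj G u v

  dec : Decidable adj
  dec zero    zero    = no λ ()
  dec zero    (suc v) = v ∈? S
  dec (suc u) zero    = u ∈? S
  dec (suc u) (suc v) = Graph.adj? G u v

  symm : ∀ u v → adj u v → adj v u
  symm zero    (suc v) p = p
  symm (suc u) zero    p = p
  symm (suc u) (suc v) p = Graph.sym G p

  irr : ∀ u v → u ≡ v → adj u v → ⊥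
  irr (suc u) (suc u) refl p = Graph.irrefl G refl p

-- t-trees, with the vertices numbered in reverse order of insertion.  Every
-- t-tree is isomorphic to one of these, and IsPartialTree below is invariant
-- under isomorphism.
data IsTree (t : ℕ) : Graph → Set₁ where
  clique : IsTree t (K t)
  extend : ∀ {G} (S : Subset (order G)) → IsTree t G →
           IsClique G S → ∣ S ∣ ≡ t → IsTree t (addVertex G S)

-- G is isomorphic to a (not necessarily induced or spanning) subgraph of H.
IsSubgraph : Graph → Graph → Set
IsSubgraph G H =
  ∃[ f ] Injective _≡_ _≡_ f × (∀ u v → Adj G u v → Adj H (f u) (f v))

IsPartialTree : ℕ → Graph → Set₁
IsPartialTree t G = ∃[ H ] IsTree t H × IsSubgraph G H

IsTreewidth : Graph → ℕ → Set₁
IsTreewidth G t = IsPartialTree t G × (∀ s → IsPartialTree s G → t ≤ s)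

-- Each vertex gets b of the colours in Fin k; adjacent vertices get disjoint
-- sets of colours.
IsFoldColoring : (G : Graph) (b k : ℕ) → (Fin (order G) → Subset k) → Set
IsFoldColoring G b k φ =
  (∀ v → ∣ φ v ∣ ≡ b) × (∀ u v → Adj G u v → Empty (φ u ∩ φ v))

-- k = χ_b(G).
IsFoldChromaticNumber : Graph → ℕ → ℕ → Set
IsFoldChromaticNumber G b k =
  ∃ (IsFoldColoring G b k) × (∀ l → ∃ (IsFoldColoring G b l) → k ≤ l)

-- χ_f(G) ≥ r, where χ_f(G) is the infimum of χ_b(G) / b over b ≥ 1: an infimum
-- is at least r exactly when r is a lower bound.
χf_≥_ : Graph → ℚ → Set
χf G ≥ r = ∀ b k .{{_ : NonZero b}} →
  IsFoldChromaticNumber G b k → r ℚ.≤ + k / b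

infix 4 χf_≥_

-- f 1 + f 2 + … + f n.
sum₁ : ℕ → (ℕ → ℚ) → ℚ
sum₁ zero    f = 0ℚ
sum₁ (suc n) f = sum₁ n f ℚ.+ f (suc n)

{-# OPTIONS --safe #-}
module Submission where

-- Let H(m, 0) = K_m, and let H(m, n) consist of a vertex w, a clique u_1, …, u_m
-- not adjacent to w, and for each j a copy of H(m - 1, n - 1) joined to w and u_j.
-- The u_j use disjoint sets of colours, so in a b-fold colouring some u_j shares at
-- most b / m colours with w; hence
--   χ_f(H(m, n)) ≥ 2 - 1/m + χ_f(H(m - 1, n - 1)),
-- which gives the bound for H(ω, t - ω + 1).  This graph has clique number ω and
-- treewidth at most t; a disjoint K_{t,t} makes the treewidth equal to t.  All of
-- it is built by adding vertices to a partial t-tree, the neighbourhood of each new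
-- vertex lying in a bag, a list of at most t vertices that is a clique of the t-tree.

open import Defs
open import Data.Bool.Base using (true; false)
open import Data.Empty as Empty using (⊥-elim)
open import Data.Fin using (Fin; zero; suc; _≟_)
open import Data.Fin.Properties using (suc-injective)
open import Data.Fin.Subset as Subset
  using (Subset; inside; outside; Empty; ⋃; ⁅_⁆; _∪_; _∩_; _─_; ⊥; ⊤)
  renaming (∣_∣ to card)
open import Data.Fin.Subset.Properties
open import Data.Integer as ℤ using (+_)
import Data.Integer.Properties as ℤ
open import Data.List.Base using (List; []; _∷_; _++_; map; length; allFin)
open import Data.List.Membership.Propositional using (_∈_; _∉_; lose; find)
open import Data.List.Membership.Propositional.Properties
  using (∈-map⁺; ∈-map⁻; ∈-++⁻; ∈-++⁺ˡ; ∈-allFin)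
open import Data.List.Properties using (length-map; length-tabulate; map-++)
open import Data.List.Relation.Binary.Subset.Propositional using (_⊆_)
open import Data.List.Relation.Binary.Subset.Propositional.Properties
  using () renaming (map⁺ to ⊆-map⁺)
open import Data.List.Relation.Unary.All as All using ([]; _∷_)
import Data.List.Relation.Unary.All.Properties as All
open import Data.List.Relation.Unary.AllPairs as AllPairs using (AllPairs; []; _∷_)
import Data.List.Relation.Unary.AllPairs.Properties as AllPairs
open import Data.List.Relation.Unary.Any using (here; there; any?)
open import Data.List.Relation.Unary.Unique.Propositional using (Unique)
import Data.List.Relation.Unary.Unique.Propositional.Properties as Unique
open import Data.Nat using (ℕ; zero; suc; _+_; _*_; _∸_; _≤_; z≤n; s≤s; s≤s⁻¹; NonZero)
import Data.Nat.Properties as ℕ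
open import Data.Nat.Tactic.RingSolver using (solve-∀)
open import Data.Product using (Σ; _×_; _,_; proj₁; proj₂; ∃; ∃-syntax)
open import Data.Rational as ℚ using (ℚ; _/_; _-_)
import Data.Rational.Properties as ℚ
open import Data.Rational.Unnormalised as ℚᵘ using (mkℚᵘ; *≤*)
import Data.Rational.Unnormalised.Properties as ℚᵘ
open import Data.Sum.Base using (inj₁; inj₂; [_,_]′)
open import Data.Vec.Base using ([]; _∷_; here; there)
open import Function.Base using (_∘_; id; case_of_)
open import Function.Definitions using (Injective)
open import Relation.Binary.PropositionalEquality
open import Relation.Nullary using (¬_; yes; no; contradiction)

open Graph using (order; Adj)

private variable
  n k t : ℕ

-- Cardinalities of finite subsets

∣p∪q∣+∣p∩q∣≡∣p∣+∣q∣ : ∀ (p q : Subset n) → card (p ∪ q) + card (p ∩ q) ≡ card p + card q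
∣p∪q∣+∣p∩q∣≡∣p∣+∣q∣ [] [] = refl
∣p∪q∣+∣p∩q∣≡∣p∣+∣q∣ (true ∷ p) (true ∷ q) = cong suc (trans (ℕ.+-suc _ _)
  (trans (cong suc (∣p∪q∣+∣p∩q∣≡∣p∣+∣q∣ p q)) (sym (ℕ.+-suc _ _))))
∣p∪q∣+∣p∩q∣≡∣p∣+∣q∣ (true ∷ p) (false ∷ q) = cong suc (∣p∪q∣+∣p∩q∣≡∣p∣+∣q∣ p q)
∣p∪q∣+∣p∩q∣≡∣p∣+∣q∣ (false ∷ p) (true ∷ q) =
  trans (cong suc (∣p∪q∣+∣p∩q∣≡∣p∣+∣q∣ p q)) (sym (ℕ.+-suc _ _))
∣p∪q∣+∣p∩q∣≡∣p∣+∣q∣ (false ∷ p) (false ∷ q) = ∣p∪q∣+∣p∩q∣≡∣p∣+∣q∣ p q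

∣p∪q∣≤∣p∣+∣q∣ : ∀ (p q : Subset n) → card (p ∪ q) ≤ card p + card q
∣p∪q∣≤∣p∣+∣q∣ p q = ℕ.≤-trans (ℕ.m≤m+n _ _) (ℕ.≤-reflexive (∣p∪q∣+∣p∩q∣≡∣p∣+∣q∣ p q))

disjoint⇒∣p∪q∣≡∣p∣+∣q∣ : ∀ {p q : Subset n} → Empty (p ∩ q) → card (p ∪ q) ≡ card p + card q
disjoint⇒∣p∪q∣≡∣p∣+∣q∣ {n} {p} {q} empty = begin
  card (p ∪ q)               ≡⟨ ℕ.+-identityʳ _ ⟨
  card (p ∪ q) + 0           ≡⟨ cong (_+_ (card (p ∪ q))) (trans (cong card (Empty-unique empty)) (∣⊥∣≡0 n)) ⟨
  card (p ∪ q) + card (p ∩ q)   ≡⟨ ∣p∪q∣+∣p∩q∣≡∣p∣+∣q∣ p q ⟩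
  card p + card q           ∎
  where open ≡-Reasoning

x∈p─q⇒x∉q : ∀ (p q : Subset n) {x} → x Subset.∈ p ─ q → x Subset.∉ q
x∈p─q⇒x∉q (true ∷ p) (false ∷ q) here ()
x∈p─q⇒x∉q (_ ∷ p) (_ ∷ q) (there x∈) (there x∈q) = x∈p─q⇒x∉q p q x∈ x∈q

-- The two sets counted on the left are disjoint parts of `p ─ r`. With `p` the colours of w, `q`
-- those of a new u_j and `r` those of the vertices it is joined to, what u_j shares with w is paid
-- for out of the colours of w that are still free.
∣p∩q∣+∣p─q∪r∣≤∣p─r∣ : ∀ (p : Subset n) {q r} → Empty (q ∩ r) →
                     card (p ∩ q) + card (p ─ (q ∪ r)) ≤ card (p ─ r)
∣p∩q∣+∣p─q∪r∣≤∣p─r∣ p {q} {r} q∩r=∅ = begin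
  card (p ∩ q) + card (p ─ (q ∪ r))   ≡⟨ disjoint⇒∣p∪q∣≡∣p∣+∣q∣ disjoint ⟨
  card (p ∩ q ∪ (p ─ (q ∪ r)))     ≤⟨ p⊆q⇒∣p∣≤∣q∣ within ⟩
  card (p ─ r)                     ∎
  where
  open ℕ.≤-Reasoning
  disjoint : Empty ((p ∩ q) ∩ (p ─ (q ∪ r)))
  disjoint (x , x∈) =
    let x∈p∩q , x∈rest = x∈p∩q⁻ (p ∩ q) _ x∈
    in x∈p─q⇒x∉q p (q ∪ r) x∈rest (p⊆p∪q r (proj₂ (x∈p∩q⁻ p q x∈p∩q)))
  within : p ∩ q ∪ (p ─ (q ∪ r)) Subset.⊆ p ─ r
  within {x} x∈ with x∈p∪q⁻ (p ∩ q) _ x∈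
  ... | inj₁ x∈p∩q = let x∈p , x∈q = x∈p∩q⁻ p q x∈p∩q
                     in x∈p∧x∉q⇒x∈p─q x∈p λ x∈r → q∩r=∅ (x , x∈p∩q⁺ (x∈q , x∈r))
  ... | inj₂ x∈rest = x∈p∧x∉q⇒x∈p─q (p─q⊆p p _ x∈rest)
                        (x∈p─q⇒x∉q p (q ∪ r) x∈rest ∘ q⊆p∪q q r)

-- Inclusion-exclusion for `p` and `q ∪ r`, which meet only inside `q` because `r` misses `p`. For
-- `p` and `q` the colours of u_j and w, a small union means a large overlap.
∣p∣+∣q∣+∣r∣≤∣p∪q∪r∣+∣q∩p∣ : ∀ (p q : Subset n) {r} → Empty (p ∩ r) → Empty (q ∩ r) →
                          card r + (card p + card q) ≤ card (p ∪ (q ∪ r)) + card (q ∩ p)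
∣p∣+∣q∣+∣r∣≤∣p∪q∪r∣+∣q∩p∣ p q {r} p∩r=∅ q∩r=∅ = begin
  card r + (card p + card q)            ≡⟨ rearrange (card r) (card p) (card q) ⟩
  card p + (card q + card r)            ≡⟨ cong (_+_ (card p)) (disjoint⇒∣p∪q∣≡∣p∣+∣q∣ q∩r=∅) ⟨
  card p + card (q ∪ r)                 ≡⟨ ∣p∪q∣+∣p∩q∣≡∣p∣+∣q∣ p (q ∪ r) ⟨
  card (p ∪ (q ∪ r)) + card (p ∩ (q ∪ r)) ≤⟨ ℕ.+-monoʳ-≤ (card (p ∪ (q ∪ r))) (p⊆q⇒∣p∣≤∣q∣ within) ⟩
  card (p ∪ (q ∪ r)) + card (q ∩ p)     ∎
  where
  open ℕ.≤-Reasoning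
  rearrange : ∀ x y z → x + (y + z) ≡ y + (z + x)
  rearrange = solve-∀
  within : p ∩ (q ∪ r) Subset.⊆ q ∩ p
  within {x} x∈ with x∈p , x∈q∪r ← x∈p∩q⁻ p (q ∪ r) x∈ with x∈p∪q⁻ q r x∈q∪r
  ... | inj₁ x∈q = x∈p∩q⁺ (x∈q , x∈p)
  ... | inj₂ x∈r = contradiction (x , x∈p∩q⁺ (x∈p , x∈r)) p∩r=∅

interpolate : ∀ {p q : Subset n} {j} → p Subset.⊆ q → card p ≤ j → j ≤ card q →
              ∃[ r ] p Subset.⊆ r × r Subset.⊆ q × card r ≡ j
interpolate {p = []} {[]} p⊆q _ j≤ = [] , id , id , sym (ℕ.n≤0⇒n≡0 j≤)
interpolate {p = true ∷ p} {true ∷ q} p⊆q (s≤s lo) (s≤s hi) =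
  let r , p⊆r , r⊆q , ∣r∣ = interpolate (drop-∷-⊆ p⊆q) lo hi
  in inside ∷ r , s⊆s p⊆r , s⊆s r⊆q , cong suc ∣r∣
interpolate {p = true ∷ p} {false ∷ q} p⊆q _ _ with () ← p⊆q here
interpolate {p = false ∷ p} {false ∷ q} p⊆q lo hi =
  let r , p⊆r , r⊆q , ∣r∣ = interpolate (drop-∷-⊆ p⊆q) lo hi
  in outside ∷ r , s⊆s p⊆r , s⊆s r⊆q , ∣r∣
interpolate {p = false ∷ p} {true ∷ q} {j} p⊆q lo hi with j ℕ.≤? card q
... | yes j≤∣q∣ =
  let r , p⊆r , r⊆q , ∣r∣ = interpolate (λ x∈p → drop-there (p⊆q (there x∈p))) lo j≤∣q∣
  in outside ∷ r , s⊆s p⊆r , out⊆ r⊆q , ∣r∣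
-- Here `j` is the size of the whole larger set, so nothing may be skipped.
... | no j≰∣q∣ = inside ∷ q , p⊆q , id , ℕ.≤-antisym (ℕ.≰⇒> j≰∣q∣) hi

-- Unions over lists

colours : ∀ {A : Set} → (A → Subset k) → List A → Subset k
colours φ L = ⋃ (map φ L)

module _ {A : Set} where

  ∈-colours⁺ : ∀ (φ : A → Subset k) {L x c} → x ∈ L → c Subset.∈ φ x → c Subset.∈ colours φ L
  ∈-colours⁺ φ (here refl) c∈ = p⊆p∪q _ c∈
  ∈-colours⁺ φ (there x∈L) c∈ = q⊆p∪q _ _ (∈-colours⁺ φ x∈L c∈)

  ∈-colours⁻ : ∀ (φ : A → Subset k) {L c} → c Subset.∈ colours φ L →
               ∃[ x ] x ∈ L × c Subset.∈ φ x
  ∈-colours⁻ φ {[]} c∈ = ⊥-elim (∉⊥ c∈)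
  ∈-colours⁻ φ {x ∷ L} c∈ with x∈p∪q⁻ (φ x) _ c∈
  ... | inj₁ c∈φx = x , here refl , c∈φx
  ... | inj₂ c∈L = let y , y∈L , c∈φy = ∈-colours⁻ φ {L} c∈L in y , there y∈L , c∈φy

  disjoint-colours : ∀ {p : Subset k} {φ : A → Subset k} {L} →
    (∀ {x} → x ∈ L → Empty (p ∩ φ x)) → Empty (p ∩ colours φ L)
  disjoint-colours {p = p} {φ} {L} disjoint (c , c∈) =
    let c∈p , c∈L = x∈p∩q⁻ p _ c∈
        x , x∈L , c∈φx = ∈-colours⁻ φ {L} c∈L
    in disjoint x∈L (c , x∈p∩q⁺ (c∈p , c∈φx))

  colours-map : ∀ {B : Set} (φ : B → Subset k) (g : A → B) L →
                colours φ (map g L) ≡ colours (φ ∘ g) L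
  colours-map φ g [] = refl
  colours-map φ g (x ∷ L) = cong (φ (g x) ∪_) (colours-map φ g L)

fromList : List (Fin n) → Subset n
fromList = colours ⁅_⁆

∈-fromList⁺ : ∀ {L} {x : Fin n} → x ∈ L → x Subset.∈ fromList L
∈-fromList⁺ {x = x} x∈L = ∈-colours⁺ ⁅_⁆ x∈L (x∈⁅x⁆ x)

∈-fromList⁻ : ∀ L {x : Fin n} → x Subset.∈ fromList L → x ∈ L
∈-fromList⁻ L x∈ =
  let y , y∈L , x∈⁅y⁆ = ∈-colours⁻ ⁅_⁆ {L} x∈
  in subst (_∈ L) (sym (x∈⁅y⁆⇒x≡y y x∈⁅y⁆)) y∈L

∣fromList∣≤length : ∀ (L : List (Fin n)) → card (fromList L) ≤ length L
∣fromList∣≤length {n} [] = ℕ.≤-reflexive (∣⊥∣≡0 n)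
∣fromList∣≤length (x ∷ L) = begin
  card (⁅ x ⁆ ∪ fromList L)       ≤⟨ ∣p∪q∣≤∣p∣+∣q∣ ⁅ x ⁆ _ ⟩
  card ⁅ x ⁆ + card (fromList L)   ≤⟨ ℕ.+-mono-≤ (ℕ.≤-reflexive (∣⁅x⁆∣≡1 x)) (∣fromList∣≤length L) ⟩
  suc (length L)               ∎
  where open ℕ.≤-Reasoning

-- Cliques

-- A bag may be too small for `extend`, which asks for exactly t neighbours. If the youngest vertex
-- is not in `C`, the clique grows among the older ones; if it is, the rest of `C` lies in its
-- neighbourhood, a t-clique, and t - 1 vertices of that suffice.
growClique : ∀ {T} → IsTree t T → ∀ C → IsClique T C → card C ≤ t →
             ∃[ S ] C Subset.⊆ S × IsClique T S × card S ≡ t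
growClique {t} clique C _ _ = ⊤ , ⊆⊤ , (λ _ _ _ _ u≢v → u≢v) , ∣⊤∣≡n t
growClique {t} (extend S tree _ _) (false ∷ C) C-clique ∣C∣≤t =
  let S′ , C⊆S′ , S′-clique , ∣S′∣ = growClique tree C
        (λ u v u∈ v∈ u≢v → C-clique (suc u) (suc v) (there u∈) (there v∈) (u≢v ∘ suc-injective)) ∣C∣≤t
  in outside ∷ S′ , s⊆s C⊆S′
   , (λ { (suc u) (suc v) (there u∈) (there v∈) u≢v → S′-clique u v u∈ v∈ (u≢v ∘ cong suc) })
   , ∣S′∣
growClique {suc t} (extend S tree S-clique ∣S∣) (true ∷ C) C-clique (s≤s ∣C∣≤t) =
  let R , C⊆R , R⊆S , ∣R∣ = interpolate (λ {x} x∈C → C-clique zero (suc x) here (there x∈C) λ ())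
                              ∣C∣≤t (ℕ.≤-trans (ℕ.n≤1+n t) (ℕ.≤-reflexive (sym ∣S∣)))
  in inside ∷ R , s⊆s C⊆R
   , (λ { zero zero _ _ u≢v → contradiction refl u≢v
        ; zero (suc v) _ (there v∈) _ → R⊆S v∈
        ; (suc u) zero (there u∈) _ _ → R⊆S u∈
        ; (suc u) (suc v) (there u∈) (there v∈) u≢v →
            S-clique u v (R⊆S u∈) (R⊆S v∈) (u≢v ∘ cong suc) })
   , cong suc ∣R∣

Independent : (G : Graph) → List (Fin (order G)) → Set
Independent G I = ∀ {u v} → u ∈ I → v ∈ I → ¬ Adj G u v

-- The list is covered by c independent sets.
data Cover (G : Graph) : List (Fin (order G)) → ℕ → Set where
  []  : Cover G [] 0
  _∷_⟨_⟩ : ∀ {I L M c} → Independent G I → Cover G L c → M ⊆ I ++ L → Cover G M (suc c)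

-- A clique has at most one vertex in each independent set. This bounds the cliques through a new
-- vertex by a cover of its neighbourhood.
clique≤cover : ∀ {G L c} → Cover G L c → ∀ S → IsClique G S →
               (∀ {x} → x Subset.∈ S → x ∈ L) → card S ≤ c
clique≤cover {G} [] S _ S⊆[] = begin
  card S                         ≤⟨ p⊆q⇒∣p∣≤∣q∣ {q = ⊥} (λ x∈S → case (S⊆[] x∈S) of λ ()) ⟩
  card (⊥ {n = order G})           ≡⟨ ∣⊥∣≡0 (order G) ⟩
  0                             ∎
  where open ℕ.≤-Reasoning
clique≤cover {G} {c = suc c} (_∷_⟨_⟩ {I} {L} I-indep cover M⊆) S S-clique S⊆M
  with any? (_∈? S) I
... | no ∄ = ℕ.≤-trans (clique≤cover cover S S-clique S⊆L) (ℕ.n≤1+n c)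
  where
  S⊆L : ∀ {x} → x Subset.∈ S → x ∈ L
  S⊆L x∈S = [ (λ x∈I → contradiction (lose x∈I x∈S) ∄) , id ]′ (∈-++⁻ I (M⊆ (S⊆M x∈S)))
... | yes ∃x with y , y∈I , y∈S ← find ∃x = begin
  card S                           ≤⟨ p⊆q⇒∣p∣≤∣q∣ split ⟩
  card (⁅ y ⁆ ∪ (S Subset.- y))      ≤⟨ ∣p∪q∣≤∣p∣+∣q∣ ⁅ y ⁆ _ ⟩
  card ⁅ y ⁆ + card (S Subset.- y)    ≤⟨ ℕ.+-mono-≤ (ℕ.≤-reflexive (∣⁅x⁆∣≡1 y))
                                       (clique≤cover cover (S Subset.- y) rest-clique rest⊆L) ⟩
  suc c                           ∎
  where
  open ℕ.≤-Reasoning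
  split : S Subset.⊆ ⁅ y ⁆ ∪ (S Subset.- y)
  split {x} x∈S with x ≟ y
  ... | yes refl = p⊆p∪q _ (x∈⁅x⁆ y)
  ... | no x≢y = q⊆p∪q ⁅ y ⁆ _ (x∈p∧x≢y⇒x∈p-y x∈S x≢y)
  rest⊆S : S Subset.- y Subset.⊆ S
  rest⊆S = p─q⊆p S ⁅ y ⁆
  rest-clique : IsClique G (S Subset.- y)
  rest-clique u v u∈ v∈ = S-clique u v (rest⊆S u∈) (rest⊆S v∈)
  rest⊆L : ∀ {x} → x Subset.∈ S Subset.- y → x ∈ L
  rest⊆L {x} x∈ with ∈-++⁻ I (M⊆ (S⊆M (rest⊆S x∈)))
  ... | inj₂ x∈L = x∈L
  ... | inj₁ x∈I = contradiction
    (S-clique x y (rest⊆S x∈) y∈S λ { refl → x∈p─q⇒x∉q S ⁅ y ⁆ x∈ (x∈⁅x⁆ y) })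
    (I-indep x∈I y∈I)

-- Growing partial t-trees

-- The t-tree and the embedding are kept as data, since later vertices are attached along cliques of
-- the t-tree that need not be cliques of the graph.
record Stage (t ω : ℕ) : Set₁ where
  field
    graph     : Graph
    host      : Graph
    host-tree : IsTree t host
    embed     : Fin (order graph) → Fin (order host)
    embed-inj : Injective _≡_ _≡_ embed
    embed-hom : ∀ u v → Adj graph u v → Adj host (embed u) (embed v)
    clique≤ω  : ∀ S → IsClique graph S → card S ≤ ω

  isPartialTree : IsPartialTree t graph
  isPartialTree = host , host-tree , embed , embed-inj , embed-hom

  Vertex : Set
  Vertex = Fin (order graph)

  Filled : Vertex → Vertex → Set
  Filled u v = Adj host (embed u) (embed v)

  Bag : List Vertex → Set
  Bag L = ∀ {u v} → u ∈ L → v ∈ L → u ≢ v → Filled u v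

open Stage

-- An embedding as an induced subgraph: nonadjacency is kept so that independent sets, and with them
-- covers, carry over. For edges of the host the forward direction is enough to carry over bags.
record _⊑_ {t ω} (X Y : Stage t ω) : Set where
  field
    ι          : Vertex X → Vertex Y
    ι-inj      : Injective _≡_ _≡_ ι
    adj⁺       : ∀ {u v} → Adj (graph X) u v → Adj (graph Y) (ι u) (ι v)
    adj⁻       : ∀ {u v} → Adj (graph Y) (ι u) (ι v) → Adj (graph X) u v
    filled⁺    : ∀ {u v} → Filled X u v → Filled Y (ι u) (ι v)

  bag⁺ : ∀ {L} → Bag X L → Bag Y (map ι L)
  bag⁺ bag u∈ v∈ u≢v with u , u∈L , refl ← ∈-map⁻ ι u∈ | v , v∈L , refl ← ∈-map⁻ ι v∈ =
    filled⁺ (bag u∈L v∈L (u≢v ∘ cong ι))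

  cover⁺ : ∀ {L c} → Cover (graph X) L c → Cover (graph Y) (map ι L) c
  cover⁺ [] = []
  cover⁺ (_∷_⟨_⟩ {I} {L} I-indep cover M⊆) =
    _∷_⟨_⟩ (λ u∈ v∈ → indep (∈-map⁻ ι u∈) (∈-map⁻ ι v∈)) (cover⁺ cover)
      (subst (_ ∈_) (map-++ ι I L) ∘ ⊆-map⁺ ι M⊆)
    where
    indep : ∀ {u v} → ∃ (λ x → x ∈ I × u ≡ ι x) → ∃ (λ x → x ∈ I × v ≡ ι x) → ¬ Adj (graph Y) u v
    indep (_ , x∈I , refl) (_ , y∈I , refl) = I-indep x∈I y∈I ∘ adj⁻

  neighbours⁺ : ∀ {w L} → (∀ {v} → v ∈ L → Adj (graph X) w v) →
                ∀ {v} → v ∈ map ι L → Adj (graph Y) (ι w) v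
  neighbours⁺ {w} w-adj v∈ = let x , x∈L , eq = ∈-map⁻ ι v∈
                             in subst (Adj (graph Y) (ι w)) (sym eq) (adj⁺ (w-adj x∈L))

  ∉-map⁺ : ∀ {w L} → w ∉ L → ι w ∉ map ι L
  ∉-map⁺ {L = L} w∉L w∈ = let x , x∈L , eq = ∈-map⁻ ι w∈
                          in w∉L (subst (_∈ L) (sym (ι-inj eq)) x∈L)

  coloring⁻ : ∀ {b k φ} → IsFoldColoring (graph Y) b k φ → IsFoldColoring (graph X) b k (φ ∘ ι)
  coloring⁻ (∣φ∣≡b , disjoint) = ∣φ∣≡b ∘ ι , λ u v → disjoint (ι u) (ι v) ∘ adj⁺

  isPartialTree⁻ : ∀ {s} → IsPartialTree s (graph Y) → IsPartialTree s (graph X)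
  isPartialTree⁻ (H , tree , f , f-inj , f-hom) =
    H , tree , f ∘ ι , ι-inj ∘ f-inj , λ u v → f-hom (ι u) (ι v) ∘ adj⁺

open _⊑_

module _ {t ω : ℕ} where

  ⊑-refl : {X : Stage t ω} → X ⊑ X
  ⊑-refl = record { ι = id ; ι-inj = id ; adj⁺ = id ; adj⁻ = id ; filled⁺ = id }

  ⊑-trans : {X Y Z : Stage t ω} → X ⊑ Y → Y ⊑ Z → X ⊑ Z
  ⊑-trans e f = record
    { ι = ι f ∘ ι e
    ; ι-inj = ι-inj e ∘ ι-inj f
    ; adj⁺ = adj⁺ f ∘ adj⁺ e
    ; adj⁻ = adj⁻ e ∘ adj⁻ f
    ; filled⁺ = filled⁺ f ∘ filled⁺ e
    }

  -- `N` is the neighbourhood in the graph, while `B` forms a bag with the new vertex. The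
  -- difference lets u_j share a bag with w without being adjacent to it.
  record Extension (X : Stage t ω) (N B : List (Vertex X)) : Set₁ where
    field
      stage   : Stage t ω
      old     : X ⊑ stage
      new     : Vertex stage
      new≢old : ∀ {v} → new ≢ ι old v
      new-adj⁺ : ∀ {v} → v ∈ N → Adj (graph stage) new (ι old v)
      new-adj⁻ : ∀ {v} → Adj (graph stage) new (ι old v) → v ∈ N
      new-bag  : Bag stage (new ∷ map (ι old) B)

    new-adj : ∀ {v} → v ∈ map (ι old) N → Adj (graph stage) new v
    new-adj v∈ = let _ , x∈N , eq = ∈-map⁻ (ι old) v∈
                 in subst (Adj (graph stage) new) (sym eq) (new-adj⁺ x∈N)

  opaque
    -- In the host the new vertex is joined to a t-clique containing `B`. A clique through it is the
    -- vertex itself plus a clique inside `N`, of size at most `c` by the cover.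
    extension : ∀ (X : Stage t ω) {N B c} → N ⊆ B → Bag X B → length B ≤ t →
                Cover (graph X) N c → suc c ≤ ω → Extension X N B
    extension X {N} {B} {c} N⊆B bag ∣B∣≤t cover c<ω = record
      { stage = stage′
      ; old = record { ι = suc ; ι-inj = suc-injective ; adj⁺ = id ; adj⁻ = id ; filled⁺ = id }
      ; new = zero
      ; new≢old = λ ()
      ; new-adj⁺ = ∈-fromList⁺
      ; new-adj⁻ = ∈-fromList⁻ N
      ; new-bag = λ
          { (here refl) (here refl) u≢v → contradiction refl u≢v
          ; (here refl) (there v∈) _ → new-filled (∈-map⁻ suc v∈)
          ; (there u∈) (here refl) _ → new-filledʳ (∈-map⁻ suc u∈)
          ; (there u∈) (there v∈) u≢v → old-filled (∈-map⁻ suc u∈) (∈-map⁻ suc v∈) u≢v }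
      }
      where
      f : Vertex X → Fin (order (host X))
      f = embed X

      B-clique : IsClique (host X) (fromList (map f B))
      B-clique u v u∈ v∈ u≢v
        with u , u∈B , refl ← ∈-map⁻ f (∈-fromList⁻ (map f B) u∈)
           | v , v∈B , refl ← ∈-map⁻ f (∈-fromList⁻ (map f B) v∈) = bag u∈B v∈B (u≢v ∘ cong f)

      ∣fB∣≤t : card (fromList (map f B)) ≤ t
      ∣fB∣≤t = ℕ.≤-trans (∣fromList∣≤length (map f B))
                 (ℕ.≤-trans (ℕ.≤-reflexive (length-map f B)) ∣B∣≤t)

      grown : ∃[ S ] fromList (map f B) Subset.⊆ S × IsClique (host X) S × card S ≡ t
      grown = growClique (host-tree X) (fromList (map f B)) B-clique ∣fB∣≤t

      S : Subset (order (host X))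
      S = proj₁ grown

      B⊆S : ∀ {v} → v ∈ B → f v Subset.∈ S
      B⊆S v∈B = proj₁ (proj₂ grown) (∈-fromList⁺ (∈-map⁺ f v∈B))

      G′ : Graph
      G′ = addVertex (graph X) (fromList N)

      f′ : Fin (suc (order (graph X))) → Fin (suc (order (host X)))
      f′ zero = zero
      f′ (suc v) = suc (f v)

      f′-inj : Injective _≡_ _≡_ f′
      f′-inj {zero} {zero} _ = refl
      f′-inj {suc u} {suc v} eq = cong suc (embed-inj X (suc-injective eq))

      f′-hom : ∀ u v → Adj G′ u v → Adj (addVertex (host X) S) (f′ u) (f′ v)
      f′-hom zero (suc v) adj = B⊆S (N⊆B (∈-fromList⁻ N adj))
      f′-hom (suc u) zero adj = B⊆S (N⊆B (∈-fromList⁻ N adj))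
      f′-hom (suc u) (suc v) adj = embed-hom X u v adj

      G′-clique≤ω : ∀ C → IsClique G′ C → card C ≤ ω
      G′-clique≤ω (s ∷ C) sC-clique = bound s sC-clique
        where
        C-clique : IsClique (graph X) C
        C-clique u v u∈ v∈ u≢v =
          sC-clique (suc u) (suc v) (there u∈) (there v∈) (u≢v ∘ suc-injective)
        bound : ∀ s → IsClique G′ (s ∷ C) → card (s ∷ C) ≤ ω
        bound false _ = clique≤ω X C C-clique
        bound true clq = ℕ.≤-trans (s≤s (clique≤cover cover C C-clique
          λ {x} x∈C → ∈-fromList⁻ N (clq zero (suc x) here (there x∈C) λ ()))) c<ω

      stage′ : Stage t ω
      stage′ = record
        { graph = G′
        ; host = addVertex (host X) S
        ; host-tree = extend S (host-tree X) (proj₁ (proj₂ (proj₂ grown))) (proj₂ (proj₂ (proj₂ grown)))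
        ; embed = f′
        ; embed-inj = f′-inj
        ; embed-hom = f′-hom
        ; clique≤ω = G′-clique≤ω }

      new-filled : ∀ {v} → ∃ (λ x → x ∈ B × v ≡ suc x) → Filled stage′ zero v
      new-filled (_ , x∈B , refl) = B⊆S x∈B

      new-filledʳ : ∀ {v} → ∃ (λ x → x ∈ B × v ≡ suc x) → Filled stage′ v zero
      new-filledʳ (_ , x∈B , refl) = B⊆S x∈B

      old-filled : ∀ {u v} → ∃ (λ x → x ∈ B × u ≡ suc x) → ∃ (λ x → x ∈ B × v ≡ suc x) →
                   u ≢ v → Filled stage′ u v
      old-filled (_ , x∈B , refl) (_ , y∈B , refl) u≢v = bag x∈B y∈B (u≢v ∘ cong suc)

-- For n ≤ m, numer m n / denom m n is the sum of 1 / (m - i + 1) for 1 ≤ i ≤ n.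
denom : ℕ → ℕ → ℕ
denom _       zero    = 1
denom zero    (suc n) = 1
denom (suc m) (suc n) = suc m * denom m n

numer : ℕ → ℕ → ℕ
numer _       zero    = 0
numer zero    (suc n) = 0
numer (suc m) (suc n) = denom m n + suc m * numer m n

-- Colourings of growing graphs

module _ {A : Set} where

  CliqueBound : ℕ → List A → (b k : ℕ) → (A → Subset k) → Set
  CliqueBound m J b k φ = card (colours φ J) + b * m ≤ k

  -- k / b is at least card (colours φ J) / b + m + n - numer m n / denom m n.
  ColourBound : (m n : ℕ) → List A → (b k : ℕ) → (A → Subset k) → Set
  ColourBound m n J b k φ =
    (card (colours φ J) + b * (m + n)) * denom m n ≤ k * denom m n + b * numer m n

  OverlapBound : (m n j : ℕ) → A → List A → List A → (b k : ℕ) → (A → Subset k) → Set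
  OverlapBound m n j w J L b k φ =
    j * ((card (colours φ J) + b * (2 + (m + n))) * denom m n)
      ≤ j * (k * denom m n + b * numer m n) + denom m n * card (φ w ─ colours φ L)

overlapBound-map : ∀ {A B : Set} (g : B → A) m n j {w J L b k φ} →
  OverlapBound m n j (g w) (map g J) (map g L) b k φ → OverlapBound m n j w J L b k (φ ∘ g)
overlapBound-map g m n j {w} {J} {L} {b} {k} {φ} =
  subst₂ (λ p q → j * ((card p + b * (2 + (m + n))) * denom m n)
            ≤ j * (k * denom m n + b * numer m n) + denom m n * card (φ (g w) ─ q))
    (colours-map φ g J) (colours-map φ g L)

module _ {t ω : ℕ} where

  Property : Stage t ω → Set₁
  Property X = (b k : ℕ) → (Vertex X → Subset k) → Set

  -- The extension is existential, so that gadgets can be stacked in one growing graph and their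
  -- bounds pulled back to `X`.
  Forces : (X : Stage t ω) → Property X → Set₁
  Forces X P = Σ (Stage t ω) λ Y → Σ (X ⊑ Y) λ e →
    ∀ {b k φ} → IsFoldColoring (graph Y) b k φ → P b k (φ ∘ ι e)

  forces-map : ∀ {X} {P Q : Property X} → (∀ {b k φ} → IsFoldColoring (graph X) b k φ → P b k φ → Q b k φ) →
               Forces X P → Forces X Q
  forces-map P⇒Q (Y , e , p) = Y , e , λ col → P⇒Q (coloring⁻ e col) (p col)

  forces-along : ∀ {X Y} {P : Property X} (e : X ⊑ Y) → Forces Y (λ b k φ → P b k (φ ∘ ι e)) → Forces X P
  forces-along e (Z , f , p) = Z , ⊑-trans e f , p

  -- The second property is forced on top of the stage that forces the first, which is why it must
  -- be forceable over every extension of `X`.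
  forces-both : ∀ {X} {P Q : Property X} → Forces X P →
    (∀ {Y} (e : X ⊑ Y) → Forces Y (λ b k φ → Q b k (φ ∘ ι e))) →
    Forces X (λ b k φ → P b k φ × Q b k φ)
  forces-both (Y , e , p) forceQ =
    let Z , f , q = forceQ e in Z , ⊑-trans e f , λ col → p (coloring⁻ f col) , q col

  private
    ∣new∷map∣ : ∀ {A B : Set} (g : A → B) (L : List A) {j} →
               length L + suc j ≤ suc t → suc (length (map g L)) + j ≤ suc t
    ∣new∷map∣ g L {j} le = begin
      suc (length (map g L)) + j   ≡⟨ cong (λ l → suc l + j) (length-map g L) ⟩
      suc (length L) + j           ≡⟨ ℕ.+-suc (length L) j ⟨
      length L + suc j             ≤⟨ le ⟩
      suc t                        ∎
      where open ℕ.≤-Reasoning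

    ∣L∣≤t : ∀ {l j} → l + suc j ≤ suc t → l ≤ t
    ∣L∣≤t {l} {j} le = ℕ.≤-trans (ℕ.m≤m+n l j)
                         (s≤s⁻¹ (ℕ.≤-trans (ℕ.≤-reflexive (sym (ℕ.+-suc l j))) le))

    suc-≤ : ∀ {c j} → c + suc j ≤ ω → suc c + j ≤ ω
    suc-≤ {c} {j} = ℕ.≤-trans (ℕ.≤-reflexive (sym (ℕ.+-suc c j)))

    suc≤ω : ∀ {c j} → c + suc j ≤ ω → suc c ≤ ω
    suc≤ω {c} {j} le = ℕ.≤-trans (ℕ.m≤m+n (suc c) j) (suc-≤ le)

  singleton-cover : ∀ {X : Stage t ω} {L v c} → Cover (graph X) L c → Cover (graph X) (v ∷ L) (suc c)
  singleton-cover {X} {v = v} cover =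
    _∷_⟨_⟩ {I = v ∷ []} (λ { (here refl) (here refl) → Graph.irrefl (graph X) refl }) cover id

  module _ {X : Stage t ω} {N B} (E : Extension X N B) where
    open Extension E

    new-disjoint : ∀ {b k φ J} → IsFoldColoring (graph stage) b k φ → J ⊆ N →
                   Empty (φ new ∩ colours (φ ∘ ι old) J)
    new-disjoint {φ = φ} {J} (_ , disjoint) J⊆N =
      disjoint-colours {φ = φ ∘ ι old} {J} λ v∈J → disjoint _ _ (new-adj⁺ (J⊆N v∈J))

    -- The new vertex has b colours, none of them in `colours` of its neighbourhood, and so replaces
    -- one of the summands b.
    cliqueBound-old : ∀ {m b k φ} → IsFoldColoring (graph stage) b k φ →
      CliqueBound m (new ∷ map (ι old) N) b k φ → CliqueBound (suc m) N b k (φ ∘ ι old)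
    cliqueBound-old {m} {b} {k} {φ} col bound = begin
      card C + b * suc m                                  ≡⟨ rearrange (card C) b m ⟩
      b + card C + b * m                                  ≡⟨ cong (λ a → a + card C + b * m) (proj₁ col new) ⟨
      card (φ new) + card C + b * m                       ≡⟨ cong (_+ b * m) (disjoint⇒∣p∪q∣≡∣p∣+∣q∣ (new-disjoint col id)) ⟨
      card (φ new ∪ C) + b * m                            ≡⟨ cong (λ C → card (φ new ∪ C) + b * m) (colours-map φ (ι old) N) ⟨
      card (colours φ (new ∷ map (ι old) N)) + b * m      ≤⟨ bound ⟩
      k                                                   ∎
      where
      open ℕ.≤-Reasoning
      C = colours (φ ∘ ι old) N
      rearrange : ∀ a b m → a + b * suc m ≡ b + a + b * m
      rearrange = solve-∀

  -- The case H(m, 0): each of m vertices is joined to `J` and to its predecessors. A bag and the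
  -- vertex attached to it may have t + 1 vertices together.
  forces-clique : ∀ m (X : Stage t ω) J {c} → Bag X J → Cover (graph X) J c → c + m ≤ ω →
    length J + m ≤ suc t → Forces X (CliqueBound m J)
  forces-clique zero X J bag cover _ _ = X , ⊑-refl , λ {b} {k} {φ} _ → begin
    card (colours φ J) + b * 0   ≡⟨ cong (_+_ (card (colours φ J))) (ℕ.*-zeroʳ b) ⟩
    card (colours φ J) + 0       ≡⟨ ℕ.+-identityʳ _ ⟩
    card (colours φ J)           ≤⟨ ∣p∣≤n (colours φ J) ⟩
    k                            ∎
    where open ℕ.≤-Reasoning
  forces-clique (suc m) X J bag cover c≤ω ∣J∣≤t =
    forces-along {P = CliqueBound (suc m) J} old
      (forces-map {P = CliqueBound m (new ∷ map (ι old) J)}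
                  {Q = λ b k φ → CliqueBound (suc m) J b k (φ ∘ ι old)} (cliqueBound-old E)
        (forces-clique m stage (new ∷ map (ι old) J) new-bag
          (singleton-cover {X = stage} (cover⁺ old cover)) (suc-≤ c≤ω) (∣new∷map∣ (ι old) J ∣J∣≤t)))
    where
    E = extension X {J} {J} id bag (∣L∣≤t ∣J∣≤t) cover (suc≤ω c≤ω)
    open Extension E

  -- Makes the clique number reach its bound. In the end `J` is empty; a general `J` carries the
  -- part of the clique already built.
  add-clique : ∀ j (X : Stage t ω) {J c} → Bag X J → Cover (graph X) J c → AllPairs (Adj (graph X)) J →
    c + j ≤ ω → length J + j ≤ suc t → Σ (Stage t ω) λ Y → X ⊑ Y ×
      ∃[ C ] AllPairs (Adj (graph Y)) C × length C ≡ length J + j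
  add-clique zero X {J} _ _ pairs _ _ = X , ⊑-refl , J , pairs , sym (ℕ.+-identityʳ _)
  add-clique (suc j) X {J} bag cover pairs c≤ω ∣J∣≤t =
    let Y , e , C , C-pairs , ∣C∣ = add-clique j stage new-bag
          (singleton-cover {X = stage} (cover⁺ old cover))
          (All.map⁺ (All.tabulate new-adj⁺) ∷ AllPairs.map⁺ (AllPairs.map (adj⁺ old) pairs))
          (suc-≤ c≤ω) (∣new∷map∣ (ι old) J ∣J∣≤t)
    in Y , ⊑-trans old e , C , C-pairs
     , trans ∣C∣ (trans (cong (λ l → suc l + j) (length-map (ι old) J)) (sym (ℕ.+-suc (length J) j)))
    where
    open Extension (extension X {J} {J} id bag (∣L∣≤t ∣J∣≤t) cover (suc≤ω c≤ω))

  private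
    -- Adds one more clique vertex u to the bound for j of them. `A` counts the colours of J, `U`
    -- those of u, w and J together, `o` those common to u and w; `r` and `r₁` count the free
    -- colours of w before and after u.
    average-step : ∀ {A U b M q r r₁ o R} j →
      (U + b * M) * q ≤ R → A + (b + b) ≤ U + o → o + r₁ ≤ r →
      j * ((A + b * (2 + M)) * q) ≤ j * R + q * r₁ →
      suc j * ((A + b * (2 + M)) * q) ≤ suc j * R + q * r
    average-step {A} {U} {b} {M} {q} {r} {r₁} {o} {R} j h₁ h₂ h₃ h₄ = begin
      suc j * ((A + b * (2 + M)) * q)
        ≡⟨ cong (_+ j * ((A + b * (2 + M)) * q)) (rearrange₁ A b M q) ⟩
      (A + (b + b) + b * M) * q + j * ((A + b * (2 + M)) * q)
        ≤⟨ ℕ.+-mono-≤ (ℕ.*-monoˡ-≤ q (ℕ.+-monoˡ-≤ (b * M) h₂)) h₄ ⟩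
      (U + o + b * M) * q + (j * R + q * r₁)
        ≡⟨ rearrange₂ U o (b * M) q (j * R) r₁ ⟩
      (U + b * M) * q + (j * R + q * (o + r₁))
        ≤⟨ ℕ.+-mono-≤ h₁ (ℕ.+-monoʳ-≤ (j * R) (ℕ.*-monoʳ-≤ q h₃)) ⟩
      R + (j * R + q * r)
        ≡⟨ ℕ.+-assoc R (j * R) (q * r) ⟨
      suc j * R + q * r ∎
      where
      open ℕ.≤-Reasoning
      rearrange₁ : ∀ A b M q → (A + b * (2 + M)) * q ≡ (A + (b + b) + b * M) * q
      rearrange₁ = solve-∀
      rearrange₂ : ∀ U o B q J r → (U + o + B) * q + (J + q * r) ≡ (U + B) * q + (J + q * (o + r))
      rearrange₂ = solve-∀

  module _ {X : Stage t ω} {w L J} (E : Extension X L (w ∷ L)) (J⊆L : J ⊆ L) (w∉L : w ∉ L)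
           (w-adj : ∀ {v} → v ∈ J → Adj (graph X) w v) where
    open Extension E

    -- The earlier clique vertices are dropped, because the copy of H(m, n) belonging to u_j is
    -- joined to u_j, w and J only.
    new-pair-bag : Bag stage (new ∷ ι old w ∷ map (ι old) J)
    new-pair-bag u∈ v∈ = new-bag (widen u∈) (widen v∈)
      where
      widen : new ∷ ι old w ∷ map (ι old) J ⊆ new ∷ ι old w ∷ map (ι old) L
      widen (here eq) = here eq
      widen (there (here eq)) = there (here eq)
      widen (there (there v∈)) = there (there (⊆-map⁺ (ι old) J⊆L v∈))

    -- The two vertices are not adjacent, so they enlarge the bag by two but the cover by only one.
    -- This is how the treewidth outgrows the clique number.
    new-pair-cover : ∀ {c} → Cover (graph X) J c →
                     Cover (graph stage) (new ∷ ι old w ∷ map (ι old) J) (suc c)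
    new-pair-cover coverJ = pair ∷ cover⁺ old coverJ ⟨ id ⟩
      where
      irrefl : ∀ {v} → ¬ Adj (graph stage) v v
      irrefl = Graph.irrefl (graph stage) refl
      pair : Independent (graph stage) (new ∷ ι old w ∷ [])
      pair (here refl) (here refl) = irrefl
      pair (here refl) (there (here refl)) = w∉L ∘ new-adj⁻
      pair (there (here refl)) (here refl) = w∉L ∘ new-adj⁻ ∘ Graph.sym (graph stage)
      pair (there (here refl)) (there (here refl)) = irrefl

    old-bag : Bag stage (ι old w ∷ new ∷ map (ι old) L)
    old-bag u∈ v∈ = new-bag (swap u∈) (swap v∈)
      where
      swap : ι old w ∷ new ∷ map (ι old) L ⊆ new ∷ ι old w ∷ map (ι old) L
      swap (here eq) = there (here eq)
      swap (there (here eq)) = here eq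
      swap (there (there v∈)) = there (there v∈)

    old∉ : ι old w ∉ new ∷ map (ι old) L
    old∉ (here eq) = new≢old (sym eq)
    old∉ (there w∈) = ∉-map⁺ old w∉L w∈

    -- `ColourBound` limits the union of the colours of u_j, w and J, hence forces u_j and w to
    -- overlap. The overlap is then charged to the free colours of w.
    overlapBound-old : ∀ {m n j b k φ} → IsFoldColoring (graph stage) b k φ →
      ColourBound m n (new ∷ ι old w ∷ map (ι old) J) b k φ ×
      OverlapBound m n j (ι old w) (map (ι old) J) (new ∷ map (ι old) L) b k φ →
      OverlapBound m n (suc j) w J L b k (φ ∘ ι old)
    overlapBound-old {m} {n} {j} {b} {k} {φ} col (colourBound , overlapBound) =
      average-step {A = card r} {U = card (p ∪ (q ∪ r))} {b} {m + n} {denom m n} {o = card (q ∩ p)} j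
        (subst (λ r → (card (p ∪ (q ∪ r)) + b * (m + n)) * denom m n ≤ k * denom m n + b * numer m n)
          (colours-map φ (ι old) J) colourBound)
        (subst (_≤ card (p ∪ (q ∪ r)) + card (q ∩ p))
          (cong₂ (λ x y → card r + (x + y)) (proj₁ col new) (proj₁ col (ι old w)))
          (∣p∣+∣q∣+∣r∣≤∣p∪q∪r∣+∣q∩p∣ p q (new-disjoint E col J⊆L) q∩r=∅))
        (∣p∩q∣+∣p─q∪r∣≤∣p─r∣ q (new-disjoint E col id))
        (subst₂ (λ r s → j * ((card r + b * (2 + (m + n))) * denom m n)
              ≤ j * (k * denom m n + b * numer m n) + denom m n * card (q ─ (p ∪ s)))
          (colours-map φ (ι old) J) (colours-map φ (ι old) L) overlapBound)
      where
      p q r : Subset k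
      p = φ new
      q = φ (ι old w)
      r = colours (φ ∘ ι old) J
      q∩r=∅ : Empty (q ∩ r)
      q∩r=∅ = disjoint-colours {φ = φ ∘ ι old} {J} λ v∈J → proj₂ col _ _ (adj⁺ old (w-adj v∈J))

  -- A copy of H(m, n) is to be joined to `J`. The inequalities are the room it needs: m in the
  -- clique number, and m + n in a bag of at most t + 1 vertices, the newest one included.
  ForcesColours : (m n : ℕ) → Set₁
  ForcesColours m n = ∀ (X : Stage t ω) J {c} → Bag X J → Cover (graph X) J c → c + m ≤ ω →
    length J + (m + n) ≤ suc t → Forces X (ColourBound m n J)

  -- The vertices of a clique disjoint from w are added one at a time.  By the
  -- hypothesis each of them shares many colours with w, and these shares are
  -- disjoint; the bound compares j of them with what is left of the colours of w.
  forces-overlaps : ∀ {m n} → ForcesColours m n →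
    ∀ j (X : Stage t ω) w L J {c c′} →
    J ⊆ L → w ∉ L → (∀ {v} → v ∈ J → Adj (graph X) w v) → Bag X (w ∷ L) →
    Cover (graph X) J c → suc c + m ≤ ω →
    Cover (graph X) L c′ → c′ + j ≤ ω →
    2 + length J + (m + n) ≤ suc t → suc (length L) + j ≤ suc t →
    Forces X (OverlapBound m n j w J L)
  forces-overlaps _ zero X w L J _ _ _ _ _ _ _ _ _ _ = X , ⊑-refl , λ _ → z≤n
  forces-overlaps {m} {n} ih (suc j) X w L J J⊆L w∉L w-adj bag coverJ c≤ω coverL c′≤ω ∣J∣≤t ∣L∣≤t′ =
    forces-along {P = OverlapBound m n (suc j) w J L} old
      (forces-map {P = λ b k φ → ColourBound m n (new ∷ w₁ ∷ J₁) b k φ ×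
                                 OverlapBound m n j w₁ J₁ (new ∷ L₁) b k φ}
                  {Q = λ b k φ → OverlapBound m n (suc j) w J L b k (φ ∘ ι old)}
        (λ {b} {k} {φ} → overlapBound-old E J⊆L w∉L w-adj {m} {n} {j} {b} {k} {φ})
        (forces-both {P = ColourBound m n (new ∷ w₁ ∷ J₁)} {Q = OverlapBound m n j w₁ J₁ (new ∷ L₁)}
          (ih stage (new ∷ w₁ ∷ J₁) (new-pair-bag E J⊆L w∉L w-adj)
            (new-pair-cover E J⊆L w∉L w-adj coverJ) c≤ω (subst (λ l → 2 + l + (m + n) ≤ suc t) ∣J₁∣ ∣J∣≤t))
          continue))
    where
    -- The new vertex is u_j: adjacent to all of `L`, that is, to J and the earlier clique vertices,
    -- and only sharing a bag with `w`.
    E = extension X {L} {w ∷ L} there bag (∣L∣≤t ∣L∣≤t′) coverL (suc≤ω c′≤ω)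
    open Extension E
    w₁ : Vertex stage
    w₁ = ι old w
    J₁ L₁ : List (Vertex stage)
    J₁ = map (ι old) J
    L₁ = map (ι old) L

    ∣J₁∣ : length J ≡ length J₁
    ∣J₁∣ = sym (length-map (ι old) J)

    -- The remaining clique vertices come after the copy of H(m, n) for this u_j, hence over any `Y`
    -- that contains it.
    continue : ∀ {Y} (e : stage ⊑ Y) →
      Forces Y (λ b k φ → OverlapBound m n j w₁ J₁ (new ∷ L₁) b k (φ ∘ ι e))
    continue {Y} e = forces-map
      {P = OverlapBound m n j (ι e w₁) (map (ι e) J₁) (map (ι e) (new ∷ L₁))}
      {Q = λ b k φ → OverlapBound m n j w₁ J₁ (new ∷ L₁) b k (φ ∘ ι e)}
      (λ {b} {k} {φ} _ → overlapBound-map (ι e) m n j {w₁} {J₁} {new ∷ L₁} {b} {k} {φ})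
      (forces-overlaps ih j Y (ι e w₁) (map (ι e) (new ∷ L₁)) (map (ι e) J₁)
        (⊆-map⁺ (ι e) (there ∘ ⊆-map⁺ (ι old) J⊆L))
        (∉-map⁺ e (old∉ E J⊆L w∉L w-adj))
        (neighbours⁺ e (neighbours⁺ old w-adj))
        (bag⁺ e (old-bag E J⊆L w∉L w-adj))
        (cover⁺ e (cover⁺ old coverJ)) c≤ω
        (cover⁺ e (singleton-cover {X = stage} (cover⁺ old coverL))) (suc-≤ c′≤ω)
        (subst (λ l → 2 + l + (m + n) ≤ suc t) (trans ∣J₁∣ (sym (length-map (ι e) J₁))) ∣J∣≤t)
        (∣new∷map∣ (ι e) (new ∷ L₁)
          (subst (λ l → suc l + suc j ≤ suc t) (sym (length-map (ι old) L)) ∣L∣≤t′)))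

  private
    -- At most b colours of w can be charged in total. Spread over m + 1 clique vertices this costs
    -- b / (m + 1), the new term of the harmonic sum; `q + suc m * s` and `suc m * q` are the
    -- recursions of `numer` and `denom`.
    average : ∀ {A b k r q s N} m → suc m * ((A + b * N) * q) ≤ suc m * (k * q + b * s) + q * r →
      r ≤ b → (A + b * N) * (suc m * q) ≤ k * (suc m * q) + b * (q + suc m * s)
    average {A} {b} {k} {r} {q} {s} {N} m bound r≤b = begin
      (A + b * N) * (suc m * q)                ≡⟨ rearrange₁ (A + b * N) (suc m) q ⟩
      suc m * ((A + b * N) * q)                ≤⟨ bound ⟩
      suc m * (k * q + b * s) + q * r          ≤⟨ ℕ.+-monoʳ-≤ (suc m * (k * q + b * s)) (ℕ.*-monoʳ-≤ q r≤b) ⟩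
      suc m * (k * q + b * s) + q * b          ≡⟨ rearrange₂ (suc m) k q b s ⟩
      k * (suc m * q) + b * (q + suc m * s)    ∎
      where
      open ℕ.≤-Reasoning
      rearrange₁ : ∀ x m q → x * (m * q) ≡ m * (x * q)
      rearrange₁ = solve-∀
      rearrange₂ : ∀ m k q b s → m * (k * q + b * s) + q * b ≡ k * (m * q) + b * (q + m * s)
      rearrange₂ = solve-∀

  module _ {X : Stage t ω} {J} (E : Extension X J J) where
    open Extension E

    colourBound-old : ∀ {m n b k φ} → IsFoldColoring (graph stage) b k φ →
      OverlapBound m n (suc m) new (map (ι old) J) (map (ι old) J) b k φ →
      ColourBound (suc m) (suc n) J b k (φ ∘ ι old)
    colourBound-old {m} {n} {b} {k} {φ} (∣φ∣≡b , _) bound =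
      average {A = card (colours (φ ∘ ι old) J)} {k = k} {s = numer m n} m
        (subst₂ (λ C N → suc m * ((card C + b * N) * denom m n)
              ≤ suc m * (k * denom m n + b * numer m n)
                + denom m n * card (φ new ─ colours φ (map (ι old) J)))
          (colours-map φ (ι old) J) (cong suc (sym (ℕ.+-suc m n))) bound)
        (ℕ.≤-trans (∣p─q∣≤∣p∣ (φ new) _) (ℕ.≤-reflexive (∣φ∣≡b new)))

  -- Induction along the recursion for H: first w is joined to `J`, then m + 1 clique vertices
  -- follow, each with its copy of H(m, n).
  forces-colours : ∀ m n → n ≤ m → ForcesColours m n
  forces-colours m zero _ X J bag cover c≤ω ∣J∣≤t = forces-map
    {P = CliqueBound m J} {Q = ColourBound m zero J}
    (λ {b} {k} {φ} _ → subst₂ _≤_ (rearrange₁ (card (colours φ J)) b m) (rearrange₂ k b))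
    (forces-clique m X J bag cover c≤ω (subst (λ n → length J + n ≤ suc t) (ℕ.+-identityʳ m) ∣J∣≤t))
    where
    rearrange₁ : ∀ a b m → a + b * m ≡ (a + b * (m + 0)) * 1
    rearrange₁ = solve-∀
    rearrange₂ : ∀ k b → k ≡ k * 1 + b * 0
    rearrange₂ = solve-∀
  forces-colours (suc m) (suc n) (s≤s n≤m) X J bag cover c≤ω ∣J∣≤t =
    forces-along {P = ColourBound (suc m) (suc n) J} old (forces-map
      {P = OverlapBound m n (suc m) new J₁ J₁} {Q = λ b k φ → ColourBound (suc m) (suc n) J b k (φ ∘ ι old)}
      (λ {b} {k} {φ} → colourBound-old E {m} {n} {b} {k} {φ})
      -- No clique vertex is present yet, so `L` starts as J and all colours of w are free.
      (forces-overlaps (forces-colours m n n≤m) (suc m) stage new J₁ J₁ id new∉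
        new-adj new-bag (cover⁺ old cover) (suc-≤ c≤ω) (cover⁺ old cover) c≤ω
        (subst (λ l → 2 + l + (m + n) ≤ suc t) ∣J₁∣
          (ℕ.≤-trans (ℕ.≤-reflexive (rearrange (length J) m n)) ∣J∣≤t))
        (subst (λ l → suc l + suc m ≤ suc t) ∣J₁∣
          (ℕ.≤-trans (ℕ.≤-trans (ℕ.m≤m+n _ n) (ℕ.≤-reflexive (rearrange′ (length J) m n))) ∣J∣≤t))))
    where
    rearrange : ∀ l m n → 2 + l + (m + n) ≡ l + (suc m + suc n)
    rearrange = solve-∀
    rearrange′ : ∀ l m n → suc l + suc m + n ≡ l + (suc m + suc n)
    rearrange′ = solve-∀

    E : Extension X J J
    E = extension X {J} {J} id bag
      (∣L∣≤t {j = m + suc n} ∣J∣≤t) cover (suc≤ω c≤ω)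
    open Extension E

    J₁ : List (Vertex stage)
    J₁ = map (ι old) J

    ∣J₁∣ : length J ≡ length J₁
    ∣J₁∣ = sym (length-map (ι old) J)

    new∉ : new ∉ J₁
    new∉ new∈ = let _ , _ , eq = ∈-map⁻ (ι old) new∈ in new≢old eq

-- Complete bipartite graphs

-- The youngest vertex cannot be on both sides. If it is on one side, the other side lies in its
-- neighbourhood of size s; if on neither, it can be deleted. In the initial K_s one side alone
-- already gives the bound.
biclique≤width : ∀ {s H} → IsTree s H → ∀ A B →
  (∀ {a b} → a Subset.∈ A → b Subset.∈ B → Adj H a b) → card A ≡ t → card B ≡ t → t ≤ s
biclique≤width clique A _ _ ∣A∣ _ = ℕ.≤-trans (ℕ.≤-reflexive (sym ∣A∣)) (∣p∣≤n A)
biclique≤width (extend S tree S-clique ∣S∣) (true ∷ A) (true ∷ B) adj _ _ with () ← adj here here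
biclique≤width (extend S tree S-clique refl) (true ∷ A) (false ∷ B) adj _ ∣B∣ =
  ℕ.≤-trans (ℕ.≤-reflexive (sym ∣B∣)) (p⊆q⇒∣p∣≤∣q∣ λ b∈B → adj here (there b∈B))
biclique≤width (extend S tree S-clique refl) (false ∷ A) (true ∷ B) adj ∣A∣ _ =
  ℕ.≤-trans (ℕ.≤-reflexive (sym ∣A∣)) (p⊆q⇒∣p∣≤∣q∣ λ a∈A → adj (there a∈A) here)
biclique≤width (extend S tree S-clique _) (false ∷ A) (false ∷ B) adj ∣A∣ ∣B∣ =
  biclique≤width tree A B (λ a∈A b∈B → adj (there a∈A) (there b∈B)) ∣A∣ ∣B∣

∣fromList∣≡length : ∀ {L : List (Fin n)} → Unique L → card (fromList L) ≡ length L
∣fromList∣≡length {n} {[]} [] = ∣⊥∣≡0 n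
∣fromList∣≡length {L = x ∷ L} (x∉L ∷ unique) = trans (disjoint⇒∣p∪q∣≡∣p∣+∣q∣ disjoint)
    (cong₂ _+_ (∣⁅x⁆∣≡1 x) (∣fromList∣≡length unique))
  where
  disjoint : Empty (⁅ x ⁆ ∩ fromList L)
  disjoint (y , y∈) = let y∈⁅x⁆ , y∈L = x∈p∩q⁻ ⁅ x ⁆ _ y∈
    in All.lookup x∉L (∈-fromList⁻ L y∈L) (sym (x∈⁅y⁆⇒x≡y x y∈⁅x⁆))

biclique≤treewidth : ∀ {G s A B} → Unique A → Unique B →
  (∀ {a b} → a ∈ A → b ∈ B → Adj G a b) → length A ≡ t → length B ≡ t → IsPartialTree s G → t ≤ s
biclique≤treewidth {A = A} {B} A-unique B-unique adj ∣A∣ ∣B∣ (H , tree , f , f-inj , f-hom) =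
  biclique≤width tree (fromList (map f A)) (fromList (map f B)) adj′
    (size A-unique ∣A∣) (size B-unique ∣B∣)
  where
  size : ∀ {L} → Unique L → length L ≡ t → card (fromList (map f L)) ≡ t
  size {L = L} unique ∣L∣ = trans (∣fromList∣≡length (Unique.map⁺ f-inj unique)) (trans (length-map f L) ∣L∣)
  adj′ : ∀ {a b} → a Subset.∈ fromList (map f A) → b Subset.∈ fromList (map f B) → Adj H a b
  adj′ a∈ b∈ = let a , a∈A , a≡ = ∈-map⁻ f (∈-fromList⁻ (map f A) a∈)
                   b , b∈B , b≡ = ∈-map⁻ f (∈-fromList⁻ (map f B) b∈)
               in subst₂ (Adj H) (sym a≡) (sym b≡) (f-hom a b (adj a∈A b∈B))

edgeless : ℕ → Graph
edgeless n = record { order = n ; Adj = λ _ _ → Empty.⊥ ; adj? = λ _ _ → no id ; sym = id ; irrefl = λ _ → id }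

module _ {t ω : ℕ} where

  -- The host K_t makes the t isolated vertices a bag, ready to be one side of K_{t,t}.
  edgelessStage : 1 ≤ ω → Stage t ω
  edgelessStage 1≤ω = record
    { graph = edgeless t ; host = K t ; host-tree = clique
    ; embed = id ; embed-inj = id ; embed-hom = λ _ _ → λ ()
    ; clique≤ω = λ S S-clique → ℕ.≤-trans
        (clique≤cover {G = edgeless t} ((λ _ _ → id) ∷ [] ⟨ ∈-++⁺ˡ ⟩) S S-clique λ {x} _ → ∈-allFin x) 1≤ω }

  record Biclique (j : ℕ) : Set₁ where
    field
      stage : Stage t ω
      A B : List (Vertex stage)
      A-bag : Bag stage A
      A-indep : Independent (graph stage) A
      A-unique : Unique A
      B-unique : Unique B
      adj : ∀ {a b} → a ∈ A → b ∈ B → Adj (graph stage) a b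
      ∣A∣ : length A ≡ t
      ∣B∣ : length B ≡ j

  -- Each vertex of `B` is attached to the bag `A`, which has exactly t vertices. Since `A` is
  -- independent, no clique larger than an edge arises.
  biclique : 2 ≤ ω → ∀ j → Biclique j
  biclique 2≤ω zero = record
    { stage = edgelessStage (ℕ.≤-trans (s≤s z≤n) 2≤ω) ; A = allFin t ; B = []
    ; A-bag = λ _ _ → id ; A-indep = λ _ _ → id ; A-unique = Unique.allFin⁺ t ; B-unique = []
    ; adj = λ _ () ; ∣A∣ = length-tabulate id ; ∣B∣ = refl }
  biclique 2≤ω (suc j) = record
    { stage = stage
    ; A = map (ι old) A
    ; B = new ∷ map (ι old) B
    ; A-bag = bag⁺ old A-bag
    ; A-indep = λ u∈ v∈ adj → let _ , u∈A , u≡ = ∈-map⁻ (ι old) u∈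
                                  _ , v∈A , v≡ = ∈-map⁻ (ι old) v∈
                              in A-indep u∈A v∈A (adj⁻ old (subst₂ (Adj (graph stage)) u≡ v≡ adj))
    ; A-unique = Unique.map⁺ (ι-inj old) A-unique
    ; B-unique = All.map⁺ (All.tabulate λ _ → new≢old) ∷ Unique.map⁺ (ι-inj old) B-unique
    ; adj = λ { a∈ (here refl) → Graph.sym (graph stage) (new-adj a∈)
              ; a∈ (there b∈) → let _ , a∈A , a≡ = ∈-map⁻ (ι old) a∈
                                    _ , b∈B , b≡ = ∈-map⁻ (ι old) b∈
                                in subst₂ (Adj (graph stage)) (sym a≡) (sym b≡) (adj⁺ old (adj a∈A b∈B)) }
    ; ∣A∣ = trans (length-map (ι old) A) ∣A∣
    ; ∣B∣ = cong suc (trans (length-map (ι old) B) ∣B∣)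
    }
    where
    open Biclique (biclique 2≤ω j) using (A; B; A-bag; A-indep; A-unique; B-unique; adj; ∣A∣; ∣B∣)
    open Extension (extension (Biclique.stage (biclique 2≤ω j)) {A} {A} id A-bag (ℕ.≤-reflexive ∣A∣)
      (A-indep ∷ [] ⟨ ∈-++⁺ˡ ⟩) 2≤ω)

-- Fractions

/-+ : ∀ a b c d .{{_ : NonZero b}} .{{_ : NonZero d}} .{{_ : NonZero (b * d)}} →
      (+ a / b) ℚ.+ (+ c / d) ≡ + (a * d + c * b) / (b * d)
/-+ a (suc b) c (suc d) = ℚ.toℚᵘ-injective (begin
  ℚ.toℚᵘ (+ a / suc b ℚ.+ + c / suc d)                ≈⟨ ℚ.toℚᵘ-homo-+ (+ a / suc b) (+ c / suc d) ⟩
  ℚ.toℚᵘ (+ a / suc b) ℚᵘ.+ ℚ.toℚᵘ (+ c / suc d)      ≈⟨ ℚᵘ.+-cong (ℚ.toℚᵘ-fromℚᵘ (mkℚᵘ (+ a) b)) (ℚ.toℚᵘ-fromℚᵘ (mkℚᵘ (+ c) d)) ⟩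
  mkℚᵘ (+ a ℤ.* + suc d ℤ.+ + c ℤ.* + suc b) (d + b * suc d)
    ≡⟨ cong (λ x → mkℚᵘ x (d + b * suc d)) (cong₂ ℤ._+_ (ℤ.pos-* a (suc d)) (ℤ.pos-* c (suc b))) ⟨
  mkℚᵘ (+ (a * suc d + c * suc b)) (d + b * suc d)    ≈⟨ ℚ.toℚᵘ-fromℚᵘ _ ⟨
  ℚ.toℚᵘ (+ (a * suc d + c * suc b) / (suc b * suc d)) ∎)
  where open ℚᵘ.≃-Reasoning

/-≤ : ∀ a b c d .{{_ : NonZero b}} .{{_ : NonZero d}} → a * d ≤ c * b → + a / b ℚ.≤ + c / d
/-≤ a (suc b) c (suc d) ad≤cb = ℚ.toℚᵘ-cancel-≤ (begin
  ℚ.toℚᵘ (+ a / suc b)   ≃⟨ ℚ.toℚᵘ-fromℚᵘ _ ⟩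
  mkℚᵘ (+ a) b           ≤⟨ *≤* (subst₂ ℤ._≤_ (ℤ.pos-* a (suc d)) (ℤ.pos-* c (suc b)) (ℤ.+≤+ ad≤cb)) ⟩
  mkℚᵘ (+ c) d           ≃⟨ ℚ.toℚᵘ-fromℚᵘ _ ⟨
  ℚ.toℚᵘ (+ c / suc d)   ∎)
  where open ℚᵘ.≤-Reasoning

p≤q+r⇒p-r≤q : ∀ {p q r} → p ℚ.≤ q ℚ.+ r → p - r ℚ.≤ q
p≤q+r⇒p-r≤q {p} {q} {r} p≤q+r = begin
  p - r                 ≤⟨ ℚ.+-monoˡ-≤ (ℚ.- r) p≤q+r ⟩
  q ℚ.+ r - r           ≡⟨ ℚ.+-assoc q r (ℚ.- r) ⟩
  q ℚ.+ (r - r)         ≡⟨ cong (ℚ._+_ q) (ℚ.+-inverseʳ r) ⟩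
  q ℚ.+ ℚ.0ℚ            ≡⟨ ℚ.+-identityʳ q ⟩
  q                     ∎
  where open ℚ.≤-Reasoning

-- `sum₁` splits off the last term, whereas `numer` and `denom` recurse on the first.
sum₁-suc : ∀ n f → sum₁ (suc n) f ≡ f 1 ℚ.+ sum₁ n (f ∘ suc)
sum₁-suc zero f = ℚ.+-comm ℚ.0ℚ (f 1)
sum₁-suc (suc n) f = trans (cong (ℚ._+ f (suc (suc n))) (sum₁-suc n f))
  (ℚ.+-assoc (f 1) (sum₁ n (f ∘ suc)) (f (suc (suc n))))

denom≢0 : ∀ m n → NonZero (denom m n)
denom≢0 m zero = _
denom≢0 zero (suc n) = _
denom≢0 (suc m) (suc n) = ℕ.m*n≢0 (suc m) (denom m n) {{_}} {{denom≢0 m n}}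

numer/denom : ℕ → ℕ → ℚ
numer/denom m n = _/_ (+ numer m n) (denom m n) {{denom≢0 m n}}

-- The first term for m + 1 is 1 / (m + 1), and shifting the index turns the others into the terms
-- for m.
sum₁≡numer/denom : ∀ m n → n ≤ m → sum₁ n (λ i → + 1 / suc (m ∸ i)) ≡ numer/denom m n
sum₁≡numer/denom m zero _ = refl
sum₁≡numer/denom (suc m) (suc n) (s≤s n≤m) = begin
  sum₁ (suc n) (λ i → + 1 / suc (suc m ∸ i))
    ≡⟨ sum₁-suc n (λ i → + 1 / suc (suc m ∸ i)) ⟩
  + 1 / suc m ℚ.+ sum₁ n (λ i → + 1 / suc (m ∸ i))
    ≡⟨ cong (ℚ._+_ (+ 1 / suc m)) (sum₁≡numer/denom m n n≤m) ⟩
  + 1 / suc m ℚ.+ + numer m n / denom m n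
    ≡⟨ /-+ 1 (suc m) (numer m n) (denom m n) ⟩
  + (1 * denom m n + numer m n * suc m) / (suc m * denom m n)
    ≡⟨ cong (λ s → + s / (suc m * denom m n)) (rearrange (denom m n) (numer m n) (suc m)) ⟩
  numer/denom (suc m) (suc n) ∎
  where
  open ≡-Reasoning
  instance
    denom-nonZero : NonZero (denom m n)
    denom-nonZero = denom≢0 m n
    product-nonZero : NonZero (suc m * denom m n)
    product-nonZero = denom≢0 (suc m) (suc n)
  rearrange : ∀ q s m → 1 * q + s * m ≡ q + m * s
  rearrange = solve-∀

-- The hypothesis is `ColourBound` for an empty bag, to be divided by b * `denom m n`.
m+n-sum₁≤k/b : ∀ {m n b k} .{{_ : NonZero b}} → n ≤ m →
  (b * (m + n)) * denom m n ≤ k * denom m n + b * numer m n →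
  + (m + n) / 1 - sum₁ n (λ i → + 1 / suc (m ∸ i)) ℚ.≤ + k / b
m+n-sum₁≤k/b {m} {n} {b} {k} n≤m bound = p≤q+r⇒p-r≤q (begin
  + (m + n) / 1                                   ≤⟨ /-≤ (m + n) 1 (k * q + s * b) (b * q) scaled ⟩
  + (k * q + s * b) / (b * q)                     ≡⟨ /-+ k b s q ⟨
  + k / b ℚ.+ + s / q                             ≡⟨ cong (ℚ._+_ (+ k / b)) (sum₁≡numer/denom m n n≤m) ⟨
  + k / b ℚ.+ sum₁ n (λ i → + 1 / suc (m ∸ i))    ∎)
  where
  q s : ℕ
  q = denom m n
  s = numer m n
  instance
    q≢0 : NonZero q
    q≢0 = denom≢0 m n
    bq≢0 : NonZero (b * q)
    bq≢0 = ℕ.m*n≢0 b q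
  rearrange₁ : ∀ b N q → b * N * q ≡ N * (b * q)
  rearrange₁ = solve-∀
  rearrange₂ : ∀ k q b s → k * q + b * s ≡ (k * q + s * b) * 1
  rearrange₂ = solve-∀
  scaled : (m + n) * (b * q) ≤ (k * q + s * b) * 1
  scaled = subst₂ _≤_ (rearrange₁ b (m + n) q) (rearrange₂ k q b s) bound
  open ℚ.≤-Reasoning

-- Cliques given by lists, and the assembly of the graph

pairs⇒clique : ∀ {G C} → AllPairs (Adj G) C → IsClique G (fromList C)
pairs⇒clique {G} {C} pairs u v u∈ v∈ = adjacent pairs (∈-fromList⁻ C u∈) (∈-fromList⁻ C v∈)
  where
  adjacent : ∀ {C u v} → AllPairs (Adj G) C → u ∈ C → v ∈ C → u ≢ v → Adj G u v
  adjacent (_ ∷ _) (here refl) (here refl) u≢v = contradiction refl u≢v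
  adjacent (u-adj ∷ _) (here refl) (there v∈) _ = All.lookup u-adj v∈
  adjacent (v-adj ∷ _) (there u∈) (here refl) _ = Graph.sym G (All.lookup v-adj u∈)
  adjacent (_ ∷ pairs) (there u∈) (there v∈) u≢v = adjacent pairs u∈ v∈ u≢v

pairs⇒unique : ∀ {G C} → AllPairs (Adj G) C → Unique C
pairs⇒unique {G} = AllPairs.map λ adj u≡v → Graph.irrefl G u≡v adj

corollary4p4 : (t ω : ℕ) → 1 ≤ t → 2 ≤ ω → t + 1 ≤ 2 * ω → ω ≤ t →
    Σ Graph λ G →
    IsTreewidth G t × IsCliqueNumber G ω ×
    (χf G ≥ (+ (t + 1) / 1 - sum₁ (t ∸ ω + 1) (λ i → + 1 / suc (ω ∸ i))))
corollary4p4 t ω 1≤t 2≤ω t+1≤2ω ω≤t =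
  -- H(ω, d) is attached to the empty bag, hence disjoint from K_{t,t}. Its bags need ω + d = t + 1,
  -- exactly what is available.
  let Y , e , bound = forces-colours ω d d≤ω stage [] (λ ()) [] ℕ.≤-refl
                        (ℕ.≤-reflexive (trans ω+d≡t+1 (ℕ.+-comm t 1)))
      -- A disjoint ω-clique attains the clique number; the upper bound is part of every stage.
      Z , f , C , C-pairs , ∣C∣ = add-clique ω Y {[]} (λ ()) [] [] ℕ.≤-refl (ℕ.m≤n⇒m≤1+n ω≤t)
  in graph Z
   -- K_{t,t} survives in the final graph and excludes widths below t.
   , (isPartialTree Z , λ s →
        biclique≤treewidth {G = graph stage} A-unique B-unique adj ∣A∣ ∣B∣ ∘ isPartialTree⁻ (⊑-trans e f))
   , ((fromList C , pairs⇒clique {graph Z} C-pairs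
       , trans (∣fromList∣≡length (pairs⇒unique {graph Z} C-pairs)) ∣C∣)
     , clique≤ω Z)
   , λ { b k ((φ , col) , _) →
         subst (λ N → + N / 1 - sum₁ d (λ i → + 1 / suc (ω ∸ i)) ℚ.≤ + k / b) ω+d≡t+1
           (m+n-sum₁≤k/b {k = k} d≤ω
             (subst (λ c → (c + b * (ω + d)) * denom ω d ≤ k * denom ω d + b * numer ω d)
               (∣⊥∣≡0 k) (bound (coloring⁻ f col)))) }
  where
  open Biclique (biclique {t} {ω} 2≤ω t)
  d : ℕ
  d = t ∸ ω + 1
  ω+d≡t+1 : ω + d ≡ t + 1
  ω+d≡t+1 = trans (sym (ℕ.+-assoc ω (t ∸ ω) 1)) (cong (_+ 1) (ℕ.m+[n∸m]≡n ω≤t))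
  -- This is where t + 1 ≤ 2 ω enters: the recursion for H can descend d times from ω.
  d≤ω : d ≤ ω
  d≤ω = ℕ.+-cancelˡ-≤ ω d ω (begin
    ω + d       ≡⟨ ω+d≡t+1 ⟩
    t + 1       ≤⟨ t+1≤2ω ⟩
    2 * ω       ≡⟨ cong (_+_ ω) (ℕ.+-identityʳ ω) ⟩
    ω + ω       ∎)
    where open ℕ.≤-Reasoning
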